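{- For every integer $k\ge 1$, as $d\to\infty$, $$\log_2 K(d,k)=d+O(\log^2 d),$$ where the implied constant depends only on $k$. In particular the limit $\nu(k):=\lim_{d\to\infty}\frac{\log_2 K(d,k)}{d}$ exists and $\nu(k)=1$.
   Context: Let $I(d)$ denote the graph of the $d$-dimensional hypercube (vertices are binary vectors of length $d$, adjacent when they differ in exactly one coordinate). For an integer $k\ge 1$, a $(d,k)$ circuit code (circuit code of spread $k$) is a simple cycle $C$ in $I(d)$ such that $d_{I(d)}(x,y)\ge \min\{d_C(x,y),k\}$ for all vertices $x,y$ of $C$, where $d_{I(d)}$ is the graph distance in $I(d)$ (Hamming distance) and $d_C$ is the graph distance along the cycle $C$. $K(d,k)$ denotes the maximum length (number of vertices) of a $(d,k)$ circuit code. -}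

module Defs where

open import Data.Nat using (ℕ; zero; suc; _+_; _*_; _∸_; _^_; _≤_; _⊓_; ∣_-_∣)
open import Data.Nat.Logarithm using (⌈log₂_⌉)
open import Data.Bool using (Bool; true; false; _xor_; if_then_else_)
open import Data.Vec using (Vec; []; _∷_)
open import Data.Fin using (Fin; toℕ)
open import Data.Product using (Σ; _×_)
open import Function.Definitions using (Injective)
open import Relation.Binary.PropositionalEquality using (_≡_)

Vertex : ℕ → Set
Vertex d = Vec Bool d

-- Hamming distance = graph distance in I(d).
hamming : ∀ {d} → Vertex d → Vertex d → ℕ
hamming []       []       = 0
hamming (a ∷ as) (b ∷ bs) = (if a xor b then 1 else 0) + hamming as bs

-- Distance between positions i, j (i, j < n) along a cycle of length n.
cycDist : ℕ → ℕ → ℕ → ℕ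
cycDist n i j = ∣ i - j ∣ ⊓ (n ∸ ∣ i - j ∣)

-- c : Fin n → Vertex d lists the vertices of a cycle C in order
-- (c i adjacent to c (i+1 mod n)).  C is a simple cycle (n ≥ 3, vertices
-- distinct, cyclically consecutive vertices adjacent in I(d)) and satisfies
-- the spread-k condition d_I(x,y) ≥ min(d_C(x,y), k).
record IsCircuitCode (d k n : ℕ) (c : Fin n → Vertex d) : Set where
  field
    length≥3 : 3 ≤ n
    simple   : Injective _≡_ _≡_ c
    adjacent : ∀ (i j : Fin n) → cycDist n (toℕ i) (toℕ j) ≡ 1 →
               hamming (c i) (c j) ≡ 1
    spread   : ∀ (i j : Fin n) →
               cycDist n (toℕ i) (toℕ j) ⊓ k ≤ hamming (c i) (c j)

IsMaxCircuitCodeLength : ℕ → ℕ → ℕ → Set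
IsMaxCircuitCodeLength d k K =
  (Σ (Fin K → Vertex d) λ c → IsCircuitCode d k K c) ×
  (∀ (n : ℕ) (c : Fin n → Vertex d) → IsCircuitCode d k n c → n ≤ K)

{-# OPTIONS --safe #-}
module Submission where

-- Run through the Gray code of Q_m, and between two flips rewrite a register
-- from the colour of one Gray word to that of the next, where distinct words
-- at distance at most k + 1 have distinct colours. Greedy colouring needs only
-- O(k log m) bits per colour. The register stores k + 2 copies of the colour:
-- at any two moments at most two copies are being rewritten, so the k others
-- tell apart nearby Gray words that are not consecutive. For consecutive words,
-- the parity bits of sweep make the walk a geodesic unless enough copies differ.
-- Hence a code of length at least 2 ^ m in dimension m + O(log m).

open import Defs
open import Data.Nat using (ℕ; zero; suc; _+_; _*_; _∸_; _^_; _≤_; _<_; z≤n; s≤s; z<s; s<s; _⊓_;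
  ∣_-_∣; ⌊_/2⌋; ⌈_/2⌉; NonZero; >-nonZero)
open import Data.Nat.Properties
open import Data.Nat.Tactic.RingSolver using (solve-∀)
open import Data.Nat.DivMod
open import Data.Nat.Induction using (<-rec)
open import Data.Nat.Logarithm using (⌈log₂_⌉; ⌈log₂⌉-mono-≤;
  ⌈log₂⌈n/2⌉⌉≡⌈log₂n⌉∸1; ⌈log₂2^n⌉≡n)
open import Data.Bool using (Bool; true; false; not; _xor_; if_then_else_)
open import Data.Bool.Properties using (not-involutive) renaming (_≟_ to _≟ᵇ_)
open import Data.Vec using (Vec; []; _∷_; _++_; concat; replicate; lookup; tabulate)
open import Data.Vec.Properties using (≡-dec; lookup∘tabulate; ∷-injectiveˡ; ∷-injectiveʳ)
open import Data.Fin using (Fin; zero; suc; toℕ; combine)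
open import Data.Fin.Properties using (toℕ<n; toℕ-injective; combine-injective; injective⇒≤; ¬∀⟶∃¬; all?)
  renaming (_≟_ to _≟ᶠ_)
open import Data.List using (List; []; _∷_; length; map) renaming (_++_ to _++ˡ_)
open import Data.List.Properties using (length-map; length-++)
open import Data.List.Membership.Propositional using (_∈_; _∉_)
open import Data.List.Membership.Propositional.Properties using (∈-map⁺; ∈-++⁺ˡ; ∈-++⁺ʳ)
open import Data.List.Membership.Setoid.Properties using (index-injective)
open import Data.List.Relation.Unary.Any using (here; there; index)
import Data.List.Membership.DecPropositional as DecMembership
open import Data.Product using (Σ; ∃; _×_; _,_; proj₁; proj₂)
open import Data.Sum using (_⊎_; inj₁; inj₂; [_,_]′)
open import Function using (_∘_)
open import Relation.Nullary using (Dec; yes; no; contradiction)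
open import Relation.Nullary.Decidable using (map′; _×-dec_; _→-dec_; _⊎-dec_)
open import Relation.Unary using (Decidable)
open import Relation.Binary.Definitions using (DecidableEquality)
open import Relation.Binary.PropositionalEquality using (_≡_; _≢_; refl; sym; trans; cong;
  cong₂; subst; setoid; module ≡-Reasoning)

-- The Hamming distance as a metric

bit : Bool → Bool → ℕ
bit a b = if a xor b then 1 else 0

hamming-refl : ∀ {d} (x : Vertex d) → hamming x x ≡ 0
hamming-refl []          = refl
hamming-refl (true ∷ x)  = hamming-refl x
hamming-refl (false ∷ x) = hamming-refl x

hamming-sym : ∀ {d} (x y : Vertex d) → hamming x y ≡ hamming y x
hamming-sym []          []          = refl
hamming-sym (true ∷ x)  (true ∷ y)  = hamming-sym x y
hamming-sym (true ∷ x)  (false ∷ y) = cong suc (hamming-sym x y)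
hamming-sym (false ∷ x) (true ∷ y)  = cong suc (hamming-sym x y)
hamming-sym (false ∷ x) (false ∷ y) = hamming-sym x y

bit-triangle : ∀ a b c → bit a c ≤ bit a b + bit b c
bit-triangle true  true  c     = ≤-refl
bit-triangle false false c     = ≤-refl
bit-triangle true  false true  = z≤n
bit-triangle true  false false = ≤-refl
bit-triangle false true  true  = ≤-refl
bit-triangle false true  false = z≤n

hamming-triangle : ∀ {d} (x y z : Vertex d) → hamming x z ≤ hamming x y + hamming y z
hamming-triangle []      []      []      = z≤n
hamming-triangle (a ∷ x) (b ∷ y) (c ∷ z) = begin
  bit a c + hamming x z                                 ≤⟨ +-mono-≤ (bit-triangle a b c) (hamming-triangle x y z) ⟩
  (bit a b + bit b c) + (hamming x y + hamming y z)     ≡⟨ +-assoc (bit a b) (bit b c) _ ⟩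
  bit a b + (bit b c + (hamming x y + hamming y z))     ≡⟨ cong (bit a b +_) (x∙yz≈y∙xz (bit b c) (hamming x y) (hamming y z)) ⟩
  bit a b + (hamming x y + (bit b c + hamming y z))     ≡⟨ sym (+-assoc (bit a b) (hamming x y) _) ⟩
  (bit a b + hamming x y) + (bit b c + hamming y z)     ∎
  where
  open ≤-Reasoning
  open import Algebra.Properties.CommutativeSemigroup +-commutativeSemigroup using (x∙yz≈y∙xz)

hamming≡0⇒≡ : ∀ {d} (x y : Vertex d) → hamming x y ≡ 0 → x ≡ y
hamming≡0⇒≡ []          []          _ = refl
hamming≡0⇒≡ (true ∷ x)  (true ∷ y)  e = cong (true ∷_) (hamming≡0⇒≡ x y e)
hamming≡0⇒≡ (false ∷ x) (false ∷ y) e = cong (false ∷_) (hamming≡0⇒≡ x y e)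

≢⇒0<hamming : ∀ {d} {x y : Vertex d} → x ≢ y → 0 < hamming x y
≢⇒0<hamming x≢y = n≢0⇒n>0 (λ e → x≢y (hamming≡0⇒≡ _ _ e))

0<hamming⇒≢ : ∀ {d} {x y : Vertex d} → 0 < hamming x y → x ≢ y
0<hamming⇒≢ {x = x} p refl = <⇒≢ p (sym (hamming-refl x))

hamming-++ : ∀ {m n} (x x′ : Vertex m) (y y′ : Vertex n) →
             hamming (x ++ y) (x′ ++ y′) ≡ hamming x x′ + hamming y y′
hamming-++ []      []        y y′ = refl
hamming-++ (a ∷ x) (a′ ∷ x′) y y′ =
  trans (cong (bit a a′ +_) (hamming-++ x x′ y y′)) (sym (+-assoc (bit a a′) _ _))

hamming≤dim : ∀ {d} (x y : Vertex d) → hamming x y ≤ d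
hamming≤dim []          []          = z≤n
hamming≤dim (true ∷ x)  (true ∷ y)  = m≤n⇒m≤1+n (hamming≤dim x y)
hamming≤dim (true ∷ x)  (false ∷ y) = s≤s (hamming≤dim x y)
hamming≤dim (false ∷ x) (true ∷ y)  = s≤s (hamming≤dim x y)
hamming≤dim (false ∷ x) (false ∷ y) = m≤n⇒m≤1+n (hamming≤dim x y)

-- Gray code

odd : ℕ → Bool
odd zero    = false
odd (suc n) = not (odd n)

-- The binary reflected Gray code, lowest bit first. The last entry is the top bit alone, so the
-- word depends only on `j` modulo `2 ^ m`, and indices may run past the end of the cycle.
gray : ∀ m → ℕ → Vertex m
gray zero          j = []
gray (suc zero)    j = odd j ∷ []
gray (suc (suc m)) j = (odd j xor odd ⌊ j /2⌋) ∷ gray (suc m) ⌊ j /2⌋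

⌊1+even/2⌋ : ∀ j → odd j ≡ false → ⌊ suc j /2⌋ ≡ ⌊ j /2⌋
⌊1+even/2⌋ zero          _ = refl
⌊1+even/2⌋ (suc (suc j)) e = cong suc (⌊1+even/2⌋ j (trans (sym (not-involutive _)) e))

⌊1+odd/2⌋ : ∀ j → odd j ≡ true → ⌊ suc j /2⌋ ≡ suc ⌊ j /2⌋
⌊1+odd/2⌋ (suc zero)    _ = refl
⌊1+odd/2⌋ (suc (suc j)) e = cong suc (⌊1+odd/2⌋ j (trans (sym (not-involutive _)) e))

bit-not : ∀ a → bit a (not a) ≡ 1
bit-not true  = refl
bit-not false = refl

-- If `j` is even, `⌊ j /2⌋` stays and only the head flips. If `j` is odd, the parities of `j` and
-- of its half both flip, so the head stays and the flip happens in the tail, by induction.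
gray-step : ∀ m j → hamming (gray (suc m) j) (gray (suc m) (suc j)) ≡ 1
gray-step zero    j = trans (+-identityʳ _) (bit-not (odd j))
gray-step (suc m) j with odd j in e
... | false rewrite ⌊1+even/2⌋ j e | hamming-refl (gray (suc m) ⌊ j /2⌋) = trans (+-identityʳ _) (bit-not (odd ⌊ j /2⌋))
... | true  rewrite ⌊1+odd/2⌋ j e | gray-step m ⌊ j /2⌋ = cong (_+ 1) (h (odd ⌊ j /2⌋))
  where
  h : ∀ a → bit (not a) (not a) ≡ 0
  h true  = refl
  h false = refl

-- Two steps advance `⌊ j /2⌋` by exactly one, so already the tails differ. With a single bit the
-- words would repeat after two steps, hence dimension `2 + m`.
gray-2step : ∀ m j → gray (2 + m) j ≢ gray (2 + m) (2 + j)
gray-2step m j e =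
  0<hamming⇒≢ (≤-reflexive (sym (gray-step m ⌊ j /2⌋))) (∷-injectiveʳ e)

odd-double+ : ∀ a j → odd (a + (a + 0) + j) ≡ odd j
odd-double+ zero    j = refl
odd-double+ (suc a) j rewrite +-suc a (a + 0) =
  trans (not-involutive _) (odd-double+ a j)

odd-2^ : ∀ m → odd (2 ^ suc m) ≡ false
odd-2^ m = trans (cong odd (sym (+-identityʳ (2 ^ suc m)))) (odd-double+ (2 ^ m) 0)

⌊double+/2⌋ : ∀ a j → ⌊ a + (a + 0) + j /2⌋ ≡ a + ⌊ j /2⌋
⌊double+/2⌋ zero    j = refl
⌊double+/2⌋ (suc a) j rewrite +-suc a (a + 0) = cong suc (⌊double+/2⌋ a j)

gray-periodic : ∀ m j → gray m (2 ^ m + j) ≡ gray m j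
gray-periodic zero          j = refl
gray-periodic (suc zero)    j = cong (_∷ []) (not-involutive (odd j))
gray-periodic (suc m@(suc n)) j = cong₂ _∷_
  (cong₂ _xor_ (odd-double+ (2 ^ m) j)
    (trans (cong odd (⌊double+/2⌋ (2 ^ m) j)) (odd-double+ (2 ^ n) ⌊ j /2⌋)))
  (trans (cong (gray m) (⌊double+/2⌋ (2 ^ m) j)) (gray-periodic m ⌊ j /2⌋))

halves-injective : ∀ i j → odd i ≡ odd j → ⌊ i /2⌋ ≡ ⌊ j /2⌋ → i ≡ j
halves-injective zero          zero          _ _ = refl
halves-injective zero          (suc zero)    () _
halves-injective (suc zero)    zero          () _
halves-injective (suc zero)    (suc (suc j)) _ ()
halves-injective (suc zero)    (suc zero)    _ _ = refl
halves-injective (suc (suc i)) (suc (suc j)) p q =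
  cong (2 +_) (halves-injective i j
    (trans (sym (not-involutive _)) (trans p (not-involutive _))) (suc-injective q))

xor-cancelʳ : ∀ a b c → a xor c ≡ b xor c → a ≡ b
xor-cancelʳ true  true  _     _ = refl
xor-cancelʳ false false _     _ = refl
xor-cancelʳ true  false true  ()
xor-cancelʳ true  false false ()
xor-cancelʳ false true  true  ()
xor-cancelʳ false true  false ()

⌊/2⌋<  : ∀ a j → j < a + (a + 0) → ⌊ j /2⌋ < a
⌊/2⌋< (suc a) zero          _ = z<s
⌊/2⌋< (suc a) (suc zero)    _ = z<s
⌊/2⌋< (suc a) (suc (suc j)) (s≤s p) =
  s<s (⌊/2⌋< a j (≤-pred (subst (suc (suc j) ≤_) (+-suc a (a + 0)) p)))

gray-∷-injective : ∀ m {i j} → gray (2 + m) i ≡ gray (2 + m) j → ⌊ i /2⌋ ≡ ⌊ j /2⌋ → i ≡ j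
gray-∷-injective m {i} {j} e half≡ = halves-injective i j
  (xor-cancelʳ _ _ (odd ⌊ j /2⌋)
    (subst (λ z → (odd i xor odd z) ≡ (odd j xor odd ⌊ j /2⌋)) half≡ (∷-injectiveˡ e)))
  half≡

-- Decoding runs from the tail: it determines the half of the index by induction, and the head xor
-- the parity of that half then gives the parity of the index.
gray-injective : ∀ m {i j} → i < 2 ^ m → j < 2 ^ m → gray m i ≡ gray m j → i ≡ j
gray-injective zero       {zero}  {zero}  _ _ _ = refl
gray-injective zero       {suc i}         (s≤s ()) _ _
gray-injective zero       {zero}  {suc j} _ (s≤s ()) _
gray-injective (suc zero) {zero}          {zero}          _ _ _ = refl
gray-injective (suc zero) {suc zero}      {suc zero}      _ _ _ = refl
gray-injective (suc zero) {zero}          {suc zero}      _ _ ()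
gray-injective (suc zero) {suc zero}      {zero}          _ _ ()
gray-injective (suc zero) {suc (suc _)}                   (s≤s (s≤s ())) _ _
gray-injective (suc zero) {zero}          {suc (suc _)}   _ (s≤s (s≤s ())) _
gray-injective (suc zero) {suc zero}      {suc (suc _)}   _ (s≤s (s≤s ())) _
gray-injective (suc m@(suc n)) {i} {j} p q e = gray-∷-injective n e
  (gray-injective m (⌊/2⌋< (2 ^ m) i p) (⌊/2⌋< (2 ^ m) j q) (∷-injectiveʳ e))

-- Colourings of bounded-degree relations

-- Pigeonhole: if every colour occurred, its position would inject the colours into the shorter
-- list.
fresh : ∀ {C} (xs : List (Fin C)) → length xs < C → ∃ λ c → c ∉ xs
fresh {C} xs l<C = ¬∀⟶∃¬ C (_∈ xs) (λ c → c ∈? xs) λ all∈ →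
  <⇒≱ l<C (injective⇒≤ {f = λ c → index (all∈ c)}
    (λ {c} {c′} → index-injective (setoid (Fin C)) (all∈ c) (all∈ c′)))
  where open DecMembership (_≟ᶠ_ {C}) using (_∈?_)

-- Points are coloured one at a time, each avoiding the colours of its neighbours. Neighbourhood is
-- asked for in both directions because either of `x` and `y` may be the one coloured later.
greedy-colouring : ∀ {A : Set} → DecidableEquality A → ∀ {C} (nbr : A → List A) →
  (∀ x → length (nbr x) < C) → (xs : List A) →
  Σ (A → Fin C) λ f → ∀ {x y} → x ∈ xs → y ∈ xs → x ≢ y →
    x ∈ nbr y → y ∈ nbr x → f x ≢ f y
-- No constraint is left, but a total function is still owed; with no colours available, any point
-- would contradict `small`.
greedy-colouring _≟_ {zero}  nbr small []       = (λ x → contradiction (small x) λ ()) , λ ()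
greedy-colouring _≟_ {suc C} nbr small []       = (λ _ → zero) , λ ()
greedy-colouring {A} _≟_ {C} nbr small (z ∷ xs) = f , proper
  where
  rec = greedy-colouring _≟_ nbr small xs
  g   = proj₁ rec
  new = fresh (map g (nbr z)) (subst (_< C) (sym (length-map g (nbr z))) (small z))
  f : A → Fin C
  f x with x ≟ z
  ... | yes _ = proj₁ new
  ... | no  _ = g x
  older : ∀ {x} → x ≢ z → x ∈ z ∷ xs → x ∈ xs
  older x≢z (here x≡z) = contradiction x≡z x≢z
  older x≢z (there p)  = p
  proper : ∀ {x y} → x ∈ z ∷ xs → y ∈ z ∷ xs → x ≢ y →
           x ∈ nbr y → y ∈ nbr x → f x ≢ f y
  proper {x} {y} x∈ y∈ x≢y x∈ny y∈nx with x ≟ z | y ≟ z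
  ... | yes refl | yes refl = contradiction refl x≢y
  ... | yes refl | no _     = λ e → proj₂ new (subst (_∈ map g (nbr z)) (sym e) (∈-map⁺ g y∈nx))
  ... | no _     | yes refl = λ e → proj₂ new (subst (_∈ map g (nbr z)) e (∈-map⁺ g x∈ny))
  ... | no x≢z   | no y≢z   = proj₂ rec (older x≢z x∈) (older y≢z y∈) x≢y x∈ny y∈nx

ball : ∀ {m} → ℕ → Vertex m → List (Vertex m)
ball r       []      = [] ∷ []
ball zero    (a ∷ x) = map (a ∷_) (ball zero x)
ball (suc r) (a ∷ x) = map (a ∷_) (ball (suc r) x) ++ˡ map (not a ∷_) (ball r x)

∈-ball : ∀ {m} r (x y : Vertex m) → hamming x y ≤ r → y ∈ ball r x
∈-ball r       []          []          _       = here refl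
∈-ball zero    (true ∷ x)  (true ∷ y)  p       = ∈-map⁺ (true ∷_) (∈-ball zero x y p)
∈-ball zero    (false ∷ x) (false ∷ y) p       = ∈-map⁺ (false ∷_) (∈-ball zero x y p)
∈-ball (suc r) (true ∷ x)  (true ∷ y)  p       = ∈-++⁺ˡ (∈-map⁺ (true ∷_) (∈-ball (suc r) x y p))
∈-ball (suc r) (false ∷ x) (false ∷ y) p       = ∈-++⁺ˡ (∈-map⁺ (false ∷_) (∈-ball (suc r) x y p))
∈-ball (suc r) (true ∷ x)  (false ∷ y) (s≤s p) = ∈-++⁺ʳ (map (true ∷_) (ball (suc r) x)) (∈-map⁺ (false ∷_) (∈-ball r x y p))
∈-ball (suc r) (false ∷ x) (true ∷ y)  (s≤s p) = ∈-++⁺ʳ (map (false ∷_) (ball (suc r) x)) (∈-map⁺ (true ∷_) (∈-ball r x y p))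

-- The recursion follows Pascal's rule, and `(m+1)^(r+1) + (m+1)^r = (m+2)(m+1)^r`, which is at most
-- `(m+2)^(r+1)`.
length-ball : ∀ {m} r (x : Vertex m) → length (ball r x) ≤ suc m ^ r
length-ball r []      = ≤-reflexive (sym (^-zeroˡ r))
length-ball zero    (a ∷ x) = ≤-trans (≤-reflexive (length-map (a ∷_) (ball zero x))) (length-ball zero x)
length-ball {suc m} (suc r) (a ∷ x) = begin
  length (map (a ∷_) (ball (suc r) x) ++ˡ map (not a ∷_) (ball r x))
    ≡⟨ length-++ (map (a ∷_) (ball (suc r) x)) ⟩
  length (map (a ∷_) (ball (suc r) x)) + length (map (not a ∷_) (ball r x))
    ≡⟨ cong₂ _+_ (length-map (a ∷_) (ball (suc r) x)) (length-map (not a ∷_) (ball r x)) ⟩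
  length (ball (suc r) x) + length (ball r x)
    ≤⟨ +-mono-≤ (length-ball (suc r) x) (length-ball r x) ⟩
  suc m * suc m ^ r + suc m ^ r
    ≡⟨ +-comm (suc m * suc m ^ r) _ ⟩
  suc (suc m) * suc m ^ r
    ≤⟨ *-monoʳ-≤ (suc (suc m)) (^-monoˡ-≤ r (n≤1+n (suc m))) ⟩
  suc (suc m) ^ suc r ∎
  where open ≤-Reasoning

_≟ᵛ_ : ∀ {d} → DecidableEquality (Vertex d)
_≟ᵛ_ = ≡-dec _≟ᵇ_

-- Greedy colouring of the graph joining words at distance at most `r`. The Gray code serves here
-- merely as an injection of the `2 ^ b` colours into words of `b` bits.
separating-map : ∀ m r b → suc m ^ r < 2 ^ b →
  Σ (Vertex m → Vertex b) λ f → ∀ x y → x ≢ y → hamming x y ≤ r → f x ≢ f y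
separating-map m r b p = (λ x → gray b (toℕ (g x))) , λ x y x≢y h e →
  proj₂ col (every x) (every y) x≢y
    (∈-ball r y x (subst (_≤ r) (hamming-sym x y) h)) (∈-ball r x y h)
    (toℕ-injective (gray-injective b (toℕ<n (g x)) (toℕ<n (g y)) e))
  where
  col = greedy-colouring _≟ᵛ_ (ball r) (λ x → ≤-<-trans (length-ball r x) p)
          -- A ball of radius `m` about any word is the whole cube, so this lists every vertex.
          (ball m (gray m 0))
  g = proj₁ col
  every : ∀ x → x ∈ ball m (gray m 0)
  every x = ∈-ball m (gray m 0) x (hamming≤dim (gray m 0) x)

-- Register words

-- The register holds each bit a of the current word together with a xor π,
-- where π is the parity of the block. Passing from (a , π) to (b , not π) then
-- flips exactly one bit of every pair, whether or not a ≡ b, so that all blocks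
-- have the same length.
sweep : ∀ {n} → ℕ → Bool → Vertex n → Vertex n → Vertex (n * 2)
sweep s       π []      []      = []
sweep zero    π (a ∷ x) (b ∷ y) = a ∷ (a xor π) ∷ sweep zero π x y
sweep (suc s) π (a ∷ x) (b ∷ y) = b ∷ (b xor not π) ∷ sweep s π x y

pair-flip : ∀ a b π h → bit a b + (bit (a xor π) (b xor not π) + h) ≡ suc h
pair-flip true  true  true  h = refl
pair-flip true  true  false h = refl
pair-flip true  false true  h = refl
pair-flip true  false false h = refl
pair-flip false true  true  h = refl
pair-flip false true  false h = refl
pair-flip false false true  h = refl
pair-flip false false false h = refl

pair-same : ∀ a b h → bit a a + (bit b b + h) ≡ h
pair-same true  true  h = refl
pair-same true  false h = refl
pair-same false true  h = refl
pair-same false false h = refl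

bit-sym : ∀ a b → bit a b ≡ bit b a
bit-sym true  true  = refl
bit-sym true  false = refl
bit-sym false true  = refl
bit-sym false false = refl

-- Each advance of the cursor changes exactly one bit, and different advances act on different
-- pairs, so no change is ever undone.
sweep-geodesic : ∀ {n} s s′ π (x y : Vertex n) → s ≤ n → s′ ≤ n →
                 hamming (sweep s π x y) (sweep s′ π x y) ≡ ∣ s - s′ ∣
sweep-geodesic zero    zero     π x       y       _ _ = hamming-refl (sweep zero π x y)
sweep-geodesic zero    (suc s′) π (a ∷ x) (b ∷ y) p (s≤s q) =
  trans (pair-flip a b π _) (cong suc (sweep-geodesic zero s′ π x y z≤n q))
sweep-geodesic (suc s) zero     π (a ∷ x) (b ∷ y) (s≤s p) q = begin
  bit b a + (bit (b xor not π) (a xor π) + h) ≡⟨ cong₂ (λ i j → i + (j + h)) (bit-sym b a) (bit-sym (b xor not π) (a xor π)) ⟩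
  bit a b + (bit (a xor π) (b xor not π) + h) ≡⟨ pair-flip a b π h ⟩
  suc h                                       ≡⟨ cong suc (sweep-geodesic s zero π x y p z≤n) ⟩
  suc ∣ s - 0 ∣                               ≡⟨ cong suc (∣-∣-identityʳ s) ⟩
  suc s                                       ∎
  where
  open ≡-Reasoning
  h = hamming (sweep s π x y) (sweep zero π x y)
sweep-geodesic (suc s) (suc s′) π (a ∷ x) (b ∷ y) (s≤s p) (s≤s q) =
  trans (pair-same b (b xor not π) _) (sweep-geodesic s s′ π x y p q)

-- Pairs beyond `s` and pairs before `s′` differ by one flip each; those in between hold `y` with
-- the same parity in both words and agree. For `s < s′` the pairs in between would compare `x` with
-- `z` at equal parity, where the distance is 0 or 2.
sweep-next : ∀ {n} s s′ π (x y z : Vertex n) → s′ ≤ s → s ≤ n →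
             hamming (sweep s π x y) (sweep s′ (not π) y z) ≡ (n ∸ s) + s′
sweep-next zero    zero     π []      []      []      _       _       = refl
sweep-next zero    zero     π (a ∷ x) (b ∷ y) (c ∷ z) _       _       =
  trans (pair-flip a b π _) (cong suc (sweep-next zero zero π x y z z≤n z≤n))
sweep-next (suc s) zero     π (a ∷ x) (b ∷ y) (c ∷ z) _       (s≤s q) =
  trans (pair-same b (b xor not π) _) (sweep-next s zero π x y z z≤n q)
sweep-next {suc n} (suc s) (suc s′) π (a ∷ x) (b ∷ y) (c ∷ z) (s≤s p) (s≤s q) =
  trans (pair-flip b c (not π) _)
    (trans (cong suc (sweep-next s s′ π x y z p q)) (sym (+-suc (n ∸ s) s′)))

-- Lower bounds from repeated copies

mix : ∀ {n} → ℕ → Vertex n → Vertex n → Vertex n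
mix s       []      []      = []
mix zero    (a ∷ x) (b ∷ y) = a ∷ mix zero x y
mix (suc s) (a ∷ x) (b ∷ y) = b ∷ mix s x y

mix-zero : ∀ {n} (x y : Vertex n) → mix zero x y ≡ x
mix-zero []      []      = refl
mix-zero (a ∷ x) (b ∷ y) = cong (a ∷_) (mix-zero x y)

mix-full : ∀ {n} s (x y : Vertex n) → n ≤ s → mix s x y ≡ y
mix-full s       []      []      _       = refl
mix-full (suc s) (a ∷ x) (b ∷ y) (s≤s p) = cong (b ∷_) (mix-full s x y p)

mix-++ : ∀ {m n} s (x y : Vertex m) (x′ y′ : Vertex n) →
         mix s (x ++ x′) (y ++ y′) ≡ mix s x y ++ mix (s ∸ m) x′ y′
mix-++ s       []      []      x′ y′ = refl
mix-++ {suc m} zero (a ∷ x) (b ∷ y) x′ y′ = cong (a ∷_)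
  (trans (mix-++ zero x y x′ y′) (cong (λ i → mix zero x y ++ mix i x′ y′) (0∸n≡0 m)))
mix-++ (suc s) (a ∷ x) (b ∷ y) x′ y′ = cong (b ∷_) (mix-++ s x y x′ y′)

-- `mix` keeps the first bit of every pair of `sweep`, and dropping coordinates cannot increase the
-- distance. This removes the parities from the lower bounds.
mix≤sweep : ∀ {n} s s′ π π′ (x y x′ y′ : Vertex n) →
            hamming (mix s x y) (mix s′ x′ y′) ≤ hamming (sweep s π x y) (sweep s′ π′ x′ y′)
mix≤sweep s       s′       π π′ []      []      []        []        = z≤n
mix≤sweep zero    zero     π π′ (a ∷ x) (b ∷ y) (a′ ∷ x′) (b′ ∷ y′) =
  +-monoʳ-≤ (bit a a′) (m≤n⇒m≤o+n _ (mix≤sweep zero zero π π′ x y x′ y′))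
mix≤sweep zero    (suc s′) π π′ (a ∷ x) (b ∷ y) (a′ ∷ x′) (b′ ∷ y′) =
  +-monoʳ-≤ (bit a b′) (m≤n⇒m≤o+n _ (mix≤sweep zero s′ π π′ x y x′ y′))
mix≤sweep (suc s) zero     π π′ (a ∷ x) (b ∷ y) (a′ ∷ x′) (b′ ∷ y′) =
  +-monoʳ-≤ (bit b a′) (m≤n⇒m≤o+n _ (mix≤sweep s zero π π′ x y x′ y′))
mix≤sweep (suc s) (suc s′) π π′ (a ∷ x) (b ∷ y) (a′ ∷ x′) (b′ ∷ y′) =
  +-monoʳ-≤ (bit b b′) (m≤n⇒m≤o+n _ (mix≤sweep s s′ π π′ x y x′ y′))

copies : ∀ M {b} → Vertex b → Vertex (M * b)
copies M x = concat (replicate M x)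

1⊓-mono-∸ : ∀ s b → 1 ⊓ (s ∸ b) ≤ 1 ⊓ s
1⊓-mono-∸ s b = ⊓-monoʳ-≤ 1 (m∸n≤m s b)

1⊓-drop : ∀ s b → 0 < s → s ≤ b → 1 ⊓ (s ∸ b) < 1 ⊓ s
1⊓-drop (suc s) b _ s≤b rewrite m≤n⇒m∸n≡0 s≤b = z<s

-- Each cursor s, s′ spoils at most the one block it lies inside; 1 ⊓ s counts
-- whether it has yet to do so.
mix-block : ∀ {b} s s′ (u v u′ v′ : Vertex b) → s ≤ s′ → u ≢ u′ → u ≢ v′ → v ≢ v′ →
  suc (1 ⊓ (s ∸ b) + 1 ⊓ (s′ ∸ b)) ≤ hamming (mix s u v) (mix s′ u′ v′) + (1 ⊓ s + 1 ⊓ s′)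
mix-block {b} s s′ u v u′ v′ s≤s′ uu′ uv′ vv′ = go
  where
  h  = hamming (mix s u v) (mix s′ u′ v′)
  clean : ∀ {x y} → mix s u v ≡ x → mix s′ u′ v′ ≡ y → x ≢ y →
          suc (1 ⊓ (s ∸ b) + 1 ⊓ (s′ ∸ b)) ≤ h + (1 ⊓ s + 1 ⊓ s′)
  clean p q x≢y = +-mono-≤ (≢⇒0<hamming (λ e → x≢y (trans (sym p) (trans e q))))
                    (+-mono-≤ (1⊓-mono-∸ s b) (1⊓-mono-∸ s′ b))
  go : suc (1 ⊓ (s ∸ b) + 1 ⊓ (s′ ∸ b)) ≤ h + (1 ⊓ s + 1 ⊓ s′)
  go with s′ ≤? 0 | s′ ≤? b | s ≤? 0 | s ≤? b
  ... | yes p | _ | _ | _ = clean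
        (trans (cong (λ i → mix i u v) (n≤0⇒n≡0 (≤-trans s≤s′ p))) (mix-zero u v))
        (trans (cong (λ i → mix i u′ v′) (n≤0⇒n≡0 p)) (mix-zero u′ v′)) uu′
  ... | no p | yes q | _ | _ = m≤n⇒m≤o+n h
        (+-mono-≤-< (1⊓-mono-∸ s b) (1⊓-drop s′ b (≰⇒> p) q))
  ... | no _ | no q | yes r | _ = clean
        (trans (cong (λ i → mix i u v) (n≤0⇒n≡0 r)) (mix-zero u v))
        (mix-full s′ u′ v′ (≰⇒≥ q)) uv′
  ... | no _ | no _ | no r | yes t = m≤n⇒m≤o+n h
        (+-mono-<-≤ (1⊓-drop s b (≰⇒> r) t) (1⊓-mono-∸ s′ b))
  ... | no _ | no q | no _ | no t = clean
        (mix-full s u v (≰⇒≥ t)) (mix-full s′ u′ v′ (≰⇒≥ q)) vv′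

-- A potential argument: each block either adds to the distance or lowers `1 ⊓ s + 1 ⊓ s′`, with the
-- cursors reduced by `b` from one block to the next.
mix-copies : ∀ M {b} s s′ (u v u′ v′ : Vertex b) → s ≤ s′ → u ≢ u′ → u ≢ v′ → v ≢ v′ →
  M ≤ hamming (mix s (copies M u) (copies M v)) (mix s′ (copies M u′) (copies M v′))
        + (1 ⊓ s + 1 ⊓ s′)
mix-copies zero    s s′ u v u′ v′ _ _ _ _ = z≤n
mix-copies (suc M) {b} s s′ u v u′ v′ s≤s′ uu′ uv′ vv′ = begin
  suc M                 ≤⟨ s≤s (mix-copies M (s ∸ b) (s′ ∸ b) u v u′ v′ (∸-monoˡ-≤ b s≤s′) uu′ uv′ vv′) ⟩
  suc (h′ + e′)         ≡⟨ sym (+-suc h′ e′) ⟩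
  h′ + suc e′           ≤⟨ +-monoʳ-≤ h′ (mix-block s s′ u v u′ v′ s≤s′ uu′ uv′ vv′) ⟩
  h′ + (h + e)          ≡⟨ sym (+-assoc h′ h e) ⟩
  h′ + h + e            ≡⟨ cong (_+ e) (+-comm h′ h) ⟩
  h + h′ + e            ≡⟨ cong (_+ e) (sym (hamming-++ (mix s u v) (mix s′ u′ v′) _ _)) ⟩
  hamming (mix s u v ++ mix (s ∸ b) (copies M u) (copies M v))
          (mix s′ u′ v′ ++ mix (s′ ∸ b) (copies M u′) (copies M v′)) + e
    ≡⟨ cong₂ (λ x y → hamming x y + e) (sym (mix-++ s u v (copies M u) (copies M v)))
                                       (sym (mix-++ s′ u′ v′ (copies M u′) (copies M v′))) ⟩
  hamming (mix s (copies (suc M) u) (copies (suc M) v))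
          (mix s′ (copies (suc M) u′) (copies (suc M) v′)) + e ∎
  where
  open ≤-Reasoning
  h  = hamming (mix s u v) (mix s′ u′ v′)
  h′ = hamming (mix (s ∸ b) (copies M u) (copies M v)) (mix (s′ ∸ b) (copies M u′) (copies M v′))
  e  = 1 ⊓ s + 1 ⊓ s′
  e′ = 1 ⊓ (s ∸ b) + 1 ⊓ (s′ ∸ b)

-- Of the `2 + k` copies at most two are spoiled. As `s ≤ s′`, no intact copy compares `v` with
-- `u′`, so these two may coincide; they do for consecutive rounds.
sweep-far : ∀ k {b} s s′ π π′ (u v u′ v′ : Vertex b) → s ≤ s′ → u ≢ u′ → u ≢ v′ → v ≢ v′ →
  k ≤ hamming (sweep s π (copies (2 + k) u) (copies (2 + k) v))
              (sweep s′ π′ (copies (2 + k) u′) (copies (2 + k) v′))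
sweep-far k s s′ π π′ u v u′ v′ s≤s′ uu′ uv′ vv′ = ≤-trans
  (+-cancelʳ-≤ 2 k _ (begin
    k + 2                    ≡⟨ +-comm k 2 ⟩
    2 + k                    ≤⟨ mix-copies (2 + k) s s′ u v u′ v′ s≤s′ uu′ uv′ vv′ ⟩
    h + (1 ⊓ s + 1 ⊓ s′)     ≤⟨ +-monoʳ-≤ h (+-mono-≤ (m⊓n≤m 1 s) (m⊓n≤m 1 s′)) ⟩
    h + 2                    ∎))
  (mix≤sweep s s′ π π′ (copies (2 + k) u) (copies (2 + k) v) (copies (2 + k) u′) (copies (2 + k) v′))
  where
  open ≤-Reasoning
  h = hamming (mix s (copies (2 + k) u) (copies (2 + k) v)) (mix s′ (copies (2 + k) u′) (copies (2 + k) v′))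

-- The cycle

module Construction
  (k m b : ℕ) (1≤k : 1 ≤ k)
  (f : Vertex (2 + m) → Vertex b)
  (f-separates : ∀ x y → x ≢ y → hamming x y ≤ suc k → f x ≢ f y)
  where

  -- A round consists of `n` register flips and one Gray flip, `S` steps in all; there is one round
  -- for each of the `N` Gray words.
  n N S L : ℕ
  n = (2 + k) * b
  N = 2 ^ (2 + m)
  S = suc n
  L = N * S

  g : ℕ → Vertex (2 + m)
  g = gray (2 + m)

  register : ℕ → Vertex n
  register j = copies (2 + k) (f (g j))

  phase : ℕ → ℕ → Vertex (n * 2)
  phase j s = sweep s (odd j) (register j) (register (suc j))

  state : ℕ → ℕ → Vertex (2 + m + n * 2)
  state j s = g j ++ phase j s

  hamming-state : ∀ j s j′ s′ → hamming (state j s) (state j′ s′) ≡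
                  hamming (g j) (g j′) + hamming (phase j s) (phase j′ s′)
  hamming-state j s j′ s′ = hamming-++ (g j) (g j′) (phase j s) (phase j′ s′)

  g-periodic : ∀ j → g (N + j) ≡ g j
  g-periodic = gray-periodic (2 + m)

  g[N]≡g[0] : g N ≡ g 0
  g[N]≡g[0] = trans (cong g (sym (+-identityʳ N))) (g-periodic 0)

  -- Round `N` repeats round 0 because both Gray words involved recur and because `N` is even, so
  -- that the block parity matches as well.
  state-periodic : ∀ s → state N s ≡ state 0 s
  state-periodic s = trans
    (cong₂ (λ x π → x ++ sweep s π (copies (2 + k) (f x)) (register (suc N)))
      g[N]≡g[0] (odd-2^ (suc m)))
    (cong (λ y → g 0 ++ sweep s false (register 0) (copies (2 + k) (f y)))
      (trans (cong g (+-comm 1 N)) (g-periodic 1)))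

  same : ∀ j s s′ → s ≤ n → s′ ≤ n → hamming (state j s) (state j s′) ≡ ∣ s - s′ ∣
  same j s s′ p q = trans (hamming-state j s j s′)
    (cong₂ _+_ (hamming-refl (g j))
      (sweep-geodesic s s′ (odd j) (register j) (register (suc j)) p q))

  next-exact : ∀ j s s′ → s′ ≤ s → s ≤ n →
               hamming (state j s) (state (suc j) s′) ≡ suc ((n ∸ s) + s′)
  next-exact j s s′ p q = trans (hamming-state j s (suc j) s′)
    (cong₂ _+_ (gray-step (suc m) j)
      (sweep-next s s′ (odd j) (register j) (register (suc j)) (register (2 + j)) p q))

  g-step≤ : ∀ j → hamming (g j) (g (suc j)) ≤ 1
  g-step≤ j = ≤-reflexive (gray-step (suc m) j)

  f-step : ∀ j → f (g j) ≢ f (g (suc j))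
  f-step j = f-separates (g j) (g (suc j))
    (0<hamming⇒≢ (≤-reflexive (sym (gray-step (suc m) j))))
    (≤-trans (g-step≤ j) (s≤s z≤n))

  -- Two Gray steps cover distance at most 2, which lies within the separation radius `suc k` since
  -- `1 ≤ k`.
  f-2step : ∀ j → f (g j) ≢ f (g (2 + j))
  f-2step j = f-separates (g j) (g (2 + j)) (gray-2step m j)
    (≤-trans (hamming-triangle (g j) (g (suc j)) (g (2 + j)))
      (≤-trans (+-mono-≤ (g-step≤ j) (g-step≤ (suc j))) (s≤s 1≤k)))

  -- If the later cursor is not ahead, the walk between the two states is a geodesic. Otherwise
  -- `sweep-far` applies with the shared colour of `g (suc j)` in the roles of `v` and `u′`.
  next : ∀ j s s′ → s ≤ n → k ≤ hamming (state j s) (state (suc j) s′) ⊎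
         hamming (state j s) (state (suc j) s′) ≡ suc ((n ∸ s) + s′)
  next j s s′ s≤n with ≤-total s′ s
  ... | inj₁ s′≤s = inj₂ (next-exact j s s′ s′≤s s≤n)
  ... | inj₂ s≤s′ = inj₁ (≤-trans
    (m≤n⇒m≤o+n (hamming (g j) (g (suc j)))
      (sweep-far k s s′ (odd j) (odd (suc j)) (f (g j)) (f (g (suc j))) (f (g (suc j))) (f (g (2 + j)))
        s≤s′ (f-step j) (f-2step j) (f-step (suc j))))
    (≤-reflexive (sym (hamming-state j s (suc j) s′))))

  -- Either the Gray words alone differ in `k` places, or they are at distance at most `k - 1`. One
  -- further Gray step on each side then gives at most `k + 1`, which is why `f` separates up to
  -- that radius.
  far : ∀ j s j′ s′ →
        g j ≢ g j′ → g j ≢ g (suc j′) → g (suc j) ≢ g j′ → g (suc j) ≢ g (suc j′) →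
        k ≤ hamming (state j s) (state j′ s′)
  far j s j′ s′ g₀₀ g₀₁ g₁₀ g₁₁ = ≤-trans split (≤-reflexive (sym (hamming-state j s j′ s′)))
    where
    open ≤-Reasoning
    h₀ = hamming (g j) (g j′)
    h₁ = hamming (phase j s) (phase j′ s′)
    split : k ≤ h₀ + h₁
    split with k ≤? h₀
    ... | yes k≤h = m≤n⇒m≤n+o h₁ k≤h
    ... | no  k≰h = m≤n⇒m≤o+n h₀ apart
      where
      h<k = ≰⇒> k≰h
      extendʳ : ∀ i → hamming (g i) (g (suc j′)) ≤ suc (hamming (g i) (g j′))
      extendʳ i = begin
        hamming (g i) (g (suc j′))                        ≤⟨ hamming-triangle (g i) (g j′) (g (suc j′)) ⟩
        hamming (g i) (g j′) + hamming (g j′) (g (suc j′)) ≤⟨ +-monoʳ-≤ _ (g-step≤ j′) ⟩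
        hamming (g i) (g j′) + 1                          ≡⟨ +-comm _ 1 ⟩
        suc (hamming (g i) (g j′))                        ∎
      extendˡ : hamming (g (suc j)) (g j′) ≤ suc h₀
      extendˡ = begin
        hamming (g (suc j)) (g j′)                        ≤⟨ hamming-triangle (g (suc j)) (g j) (g j′) ⟩
        hamming (g (suc j)) (g j) + h₀                    ≡⟨ cong (_+ h₀) (trans (hamming-sym (g (suc j)) (g j)) (gray-step (suc m) j)) ⟩
        suc h₀                                            ∎
      c₀₀ = f-separates (g j) (g j′) g₀₀ (m≤n⇒m≤1+n (<⇒≤ h<k))
      c₀₁ = f-separates (g j) (g (suc j′)) g₀₁ (≤-trans (extendʳ j) (m≤n⇒m≤1+n h<k))
      c₁₀ = f-separates (g (suc j)) (g j′) g₁₀ (≤-trans extendˡ (m≤n⇒m≤1+n h<k))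
      c₁₁ = f-separates (g (suc j)) (g (suc j′)) g₁₁
              (≤-trans (extendʳ (suc j)) (s≤s (≤-trans extendˡ h<k)))
      apart : k ≤ h₁
      apart with ≤-total s s′
      ... | inj₁ s≤s′ = sweep-far k s s′ (odd j) (odd j′) (f (g j)) (f (g (suc j))) (f (g j′)) (f (g (suc j′)))
                          s≤s′ c₀₀ c₀₁ c₁₁
      ... | inj₂ s′≤s = ≤-trans
        (sweep-far k s′ s (odd j′) (odd j) (f (g j′)) (f (g (suc j′))) (f (g j)) (f (g (suc j)))
          s′≤s (c₀₀ ∘ sym) (c₁₀ ∘ sym) (c₁₁ ∘ sym))
        (≤-reflexive (hamming-sym (phase j′ s′) (phase j s)))

  -- The condition on the ends excludes the first round against the last, which are consecutive
  -- around the cycle.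
  nonconsecutive-far : ∀ j s j′ s′ → suc j < j′ → j′ < N → (0 < j ⊎ suc j′ < N) →
         k ≤ hamming (state j s) (state j′ s′)
  nonconsecutive-far j s j′ s′ 1+j<j′ j′<N ends = far j s j′ s′
    (apart j<N j′<N (<⇒≢ j<j′))
    (wrap j<N (λ e → <⇒≢ (m<n⇒m<1+n j<j′) e) ends)
    (apart 1+j<N j′<N (<⇒≢ 1+j<j′))
    (wrap 1+j<N (λ e → <⇒≢ j<j′ (suc-injective e)) (inj₁ z<s))
    where
    j<j′  = <-trans (n<1+n j) 1+j<j′
    j<N   = <-trans j<j′ j′<N
    1+j<N = <-trans 1+j<j′ j′<N
    apart : ∀ {i i′} → i < N → i′ < N → i ≢ i′ → g i ≢ g i′
    apart p q i≢i′ e = i≢i′ (gray-injective (2 + m) p q e)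
    wrap : ∀ {i} → i < N → i ≢ suc j′ → (0 < i ⊎ suc j′ < N) → g i ≢ g (suc j′)
    wrap p i≢ (inj₂ q) = apart p q i≢
    -- If `suc j′` equals `N`, its Gray word is `g 0`, and positivity of `i` keeps the words apart.
    wrap p i≢ (inj₁ 0<i) with m≤n⇒m<n∨m≡n j′<N
    ... | inj₁ q = apart p q i≢
    ... | inj₂ e = λ gi≡ → >⇒≢ 0<i (gray-injective (2 + m) p (m^n>0 2 (2 + m))
                     (trans gi≡ (trans (cong g e) g[N]≡g[0])))

  -- The closed walk and its spread

  walk : ℕ → Vertex (2 + m + n * 2)
  walk t = state (t / S) (t % S)

  walk-at : ∀ j s → s ≤ n → walk (s + j * S) ≡ state j s
  walk-at j s s≤n = cong₂ state
    (begin
      (s + j * S) / S        ≡⟨ +-distrib-/ s (j * S) (subst (_< S) (sym %-sum) (s≤s s≤n)) ⟩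
      s / S + j * S / S      ≡⟨ cong₂ _+_ (m<n⇒m/n≡0 (s≤s s≤n)) (m*n/n≡m j S) ⟩
      j                      ∎)
    (trans ([m+kn]%n≡m%n s j S) (m<n⇒m%n≡m (s≤s s≤n)))
    where
    open ≡-Reasoning
    %-sum : s % S + j * S % S ≡ s
    %-sum = trans (cong₂ _+_ (m<n⇒m%n≡m (s≤s s≤n)) (m*n%n≡0 j S)) (+-identityʳ s)

  walk-periodic : walk L ≡ walk 0
  walk-periodic = trans (walk-at N 0 z≤n) (trans (state-periodic 0) (sym (walk-at 0 0 z≤n)))

  walk-step-at : ∀ j s → s ≤ n → hamming (walk (s + j * S)) (walk (suc s + j * S)) ≡ 1
  walk-step-at j s s≤n with m≤n⇒m<n∨m≡n s≤n
  ... | inj₁ s<n = begin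
    hamming (walk (s + j * S)) (walk (suc s + j * S)) ≡⟨ cong₂ hamming (walk-at j s s≤n) (walk-at j (suc s) s<n) ⟩
    hamming (state j s) (state j (suc s))             ≡⟨ same j s (suc s) s≤n s<n ⟩
    ∣ s - suc s ∣                                     ≡⟨ m≤n⇒∣m-n∣≡n∸m (n≤1+n s) ⟩
    suc s ∸ s                                         ≡⟨ m+n∸n≡m 1 s ⟩
    1                                                 ∎
    where open ≡-Reasoning
  -- The register is completely rewritten, so passing to the next round flips only the Gray bit.
  ... | inj₂ refl = begin
    hamming (walk (n + j * S)) (walk (suc j * S))     ≡⟨ cong₂ hamming (walk-at j n s≤n) (walk-at (suc j) 0 z≤n) ⟩
    hamming (state j n) (state (suc j) 0)             ≡⟨ next-exact j n 0 z≤n ≤-refl ⟩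
    suc ((n ∸ n) + 0)                                 ≡⟨ cong suc (trans (+-identityʳ _) (n∸n≡0 n)) ⟩
    1                                                 ∎
    where open ≡-Reasoning

  walk-step : ∀ t → hamming (walk t) (walk (suc t)) ≡ 1
  walk-step t = subst (λ i → hamming (walk i) (walk (suc i)) ≡ 1)
    (sym (m≡m%n+[m/n]*n t S)) (walk-step-at (t / S) (t % S) (≤-pred (m%n<n t S)))

  -- Within a round, and between consecutive rounds unless the distance is already `k`, the number
  -- of steps equals the Hamming distance; all other pairs of rounds are far apart. Rounds 0 and
  -- `N - 1` are joined through the closing step, along the arc of length `L ∸ δ`.
  spread-≤ : ∀ t t′ → t ≤ t′ → t′ < L →
             ((t′ ∸ t) ⊓ (L ∸ (t′ ∸ t))) ⊓ k ≤ hamming (walk t) (walk t′)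
  spread-≤ t t′ t≤t′ t′<L = [ big , [ ahead , behind ]′ ]′ cases
    where
    j = t / S
    s = t % S
    j′ = t′ / S
    s′ = t′ % S
    s≤n : s ≤ n
    s≤n = ≤-pred (m%n<n t S)
    s′≤n : s′ ≤ n
    s′≤n = ≤-pred (m%n<n t′ S)
    t≡ : t ≡ s + j * S
    t≡ = m≡m%n+[m/n]*n t S
    t′≡ : t′ ≡ s′ + j′ * S
    t′≡ = m≡m%n+[m/n]*n t′ S
    δ = t′ ∸ t
    h = hamming (state j s) (state j′ s′)
    big : k ≤ h → (δ ⊓ (L ∸ δ)) ⊓ k ≤ h
    big = m≤n⇒o⊓m≤n _
    ahead : δ ≤ h → (δ ⊓ (L ∸ δ)) ⊓ k ≤ h
    ahead p = m≤n⇒m⊓o≤n k (m≤n⇒m⊓o≤n _ p)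
    behind : L ∸ δ ≤ h → (δ ⊓ (L ∸ δ)) ⊓ k ≤ h
    behind p = m≤n⇒m⊓o≤n k (m≤n⇒o⊓m≤n δ p)
    j≤j′ : j ≤ j′
    j≤j′ = /-monoˡ-≤ S t≤t′
    j′<N : j′ < N
    j′<N = m<n*o⇒m/o<n t′<L
    -- Counts the steps from cursor `a` to cursor `c` of the next round: `n ∸ a` rewrites, one Gray
    -- flip, then `c` rewrites.
    shift : ∀ a c q → a ≤ n → c + (suc n + q) ≡ suc ((n ∸ a) + c) + (a + q)
    shift a c q a≤n = begin
      c + (suc n + q)              ≡⟨ cong (λ i → c + (suc i + q)) (sym (m∸n+n≡m a≤n)) ⟩
      c + (suc ((n ∸ a) + a) + q)  ≡⟨ lemma (n ∸ a) a c q ⟩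
      suc ((n ∸ a) + c) + (a + q)  ∎
      where
      open ≡-Reasoning
      lemma : ∀ r a c q → c + (suc (r + a) + q) ≡ suc (r + c) + (a + q)
      lemma = solve-∀
    cases : k ≤ h ⊎ (δ ≤ h ⊎ L ∸ δ ≤ h)
    cases with m≤n⇒m<n∨m≡n j≤j′
    ... | inj₂ j≡j′ = inj₂ (inj₁ (begin
          t′ ∸ t                            ≡⟨ cong₂ _∸_ (trans t′≡ (cong (λ i → s′ + i * S) (sym j≡j′))) t≡ ⟩
          (s′ + j * S) ∸ (s + j * S)        ≡⟨ cong₂ _∸_ (+-comm s′ _) (+-comm s _) ⟩
          (j * S + s′) ∸ (j * S + s)        ≡⟨ [m+n]∸[m+o]≡n∸o (j * S) s′ s ⟩
          s′ ∸ s                            ≤⟨ m∸n≤∣m-n∣ s′ s ⟩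
          ∣ s′ - s ∣                        ≡⟨ ∣-∣-comm s′ s ⟩
          ∣ s - s′ ∣                        ≡⟨ sym (same j s s′ s≤n s′≤n) ⟩
          hamming (state j s) (state j s′)  ≡⟨ cong (λ i → hamming (state j s) (state i s′)) j≡j′ ⟩
          h                                 ∎))
      where open ≤-Reasoning
    ... | inj₁ j<j′ with m≤n⇒m<n∨m≡n j<j′
    ...   | inj₂ 1+j≡j′ = [ (λ p → inj₁ (subst (k ≤_) h≡ p)) , (λ e → inj₂ (inj₁ (begin
          t′ ∸ t                            ≤⟨ m≤n+o⇒m∸n≤o t′ t (≤-reflexive (trans t′≡′ (+-comm _ t))) ⟩
          suc ((n ∸ s) + s′)                ≡⟨ sym e ⟩
          hamming (state j s) (state (suc j) s′) ≡⟨ h≡ ⟩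
          h                                 ∎))) ]′ (next j s s′ s≤n)
      where
      open ≤-Reasoning
      h≡ : hamming (state j s) (state (suc j) s′) ≡ h
      h≡ = cong (λ i → hamming (state j s) (state i s′)) 1+j≡j′
      t′≡′ : t′ ≡ suc ((n ∸ s) + s′) + t
      t′≡′ = trans t′≡ (trans (cong (λ i → s′ + i * S) (sym 1+j≡j′))
               (trans (shift s s′ (j * S) s≤n) (cong (suc ((n ∸ s) + s′) +_) (sym t≡))))
    ...   | inj₁ 1+j<j′ with 0 <? j | suc j′ <? N
    ...     | yes p | _     = inj₁ (nonconsecutive-far j s j′ s′ 1+j<j′ j′<N (inj₁ p))
    ...     | no _  | yes q = inj₁ (nonconsecutive-far j s j′ s′ 1+j<j′ j′<N (inj₂ q))
    -- Here `j` is 0 and `j′` is `N - 1`; round 0 is read as round `N`, the successor of `j′`.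
    ...     | no p  | no q  = [ (λ r → inj₁ (subst (k ≤_) h≡ r)) , (λ e → inj₂ (inj₂ (begin
          L ∸ δ                             ≤⟨ m≤n+o⇒m∸n≤o L δ L≤ ⟩
          suc ((n ∸ s′) + s)                ≡⟨ sym e ⟩
          hamming (state j′ s′) (state (suc j′) s) ≡⟨ h≡ ⟩
          h                                 ∎))) ]′ (next j′ s′ s s′≤n)
      where
      open ≤-Reasoning
      j≡0 : j ≡ 0
      j≡0 = n≤0⇒n≡0 (≮⇒≥ p)
      1+j′≡N : suc j′ ≡ N
      1+j′≡N = ≤-antisym j′<N (≮⇒≥ q)
      h≡ : hamming (state j′ s′) (state (suc j′) s) ≡ h
      h≡ = trans (cong (hamming (state j′ s′))
             (trans (cong (λ i → state i s) 1+j′≡N) (trans (state-periodic s) (cong (λ i → state i s) (sym j≡0)))))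
             (hamming-sym (state j′ s′) (state j s))
      t≡s : t ≡ s
      t≡s = trans t≡ (trans (cong (λ i → s + i * S) j≡0) (+-identityʳ s))
      L≤ : L ≤ δ + suc ((n ∸ s′) + s)
      L≤ = begin
        N * S                                   ≡⟨ cong (_* S) (sym 1+j′≡N) ⟩
        S + j′ * S                              ≡⟨ shift s′ 0 (j′ * S) s′≤n ⟩
        suc ((n ∸ s′) + 0) + (s′ + j′ * S)      ≡⟨ cong₂ (λ i i′ → suc i + i′) (+-identityʳ _) (sym t′≡) ⟩
        suc (n ∸ s′) + t′                       ≡⟨ cong (suc (n ∸ s′) +_) (sym (m+[n∸m]≡n t≤t′)) ⟩
        suc (n ∸ s′) + (t + δ)                  ≡⟨ sym (+-assoc (suc (n ∸ s′)) t δ) ⟩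
        suc (n ∸ s′) + t + δ                    ≡⟨ +-comm _ δ ⟩
        δ + suc ((n ∸ s′) + t)                  ≡⟨ cong (λ i → δ + suc ((n ∸ s′) + i)) t≡s ⟩
        δ + suc ((n ∸ s′) + s)                  ∎

  cycDist-≤ : ∀ t t′ → t ≤ t′ → cycDist L t t′ ≡ (t′ ∸ t) ⊓ (L ∸ (t′ ∸ t))
  cycDist-≤ t t′ t≤t′ = cong (λ δ → δ ⊓ (L ∸ δ)) (m≤n⇒∣m-n∣≡n∸m t≤t′)

  cycDist-sym : ∀ t t′ → cycDist L t t′ ≡ cycDist L t′ t
  cycDist-sym t t′ = cong (λ δ → δ ⊓ (L ∸ δ)) (∣-∣-comm t t′)

  walk-spread : ∀ t t′ → t < L → t′ < L → cycDist L t t′ ⊓ k ≤ hamming (walk t) (walk t′)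
  walk-spread t t′ t<L t′<L with ≤-total t t′
  ... | inj₁ t≤t′ = ≤-trans (≤-reflexive (cong (_⊓ k) (cycDist-≤ t t′ t≤t′)))
                      (spread-≤ t t′ t≤t′ t′<L)
  ... | inj₂ t′≤t = ≤-trans
    (≤-reflexive (cong (_⊓ k) (trans (cycDist-sym t t′) (cycDist-≤ t′ t t′≤t))))
    (≤-trans (spread-≤ t′ t t′≤t t<L) (≤-reflexive (hamming-sym (walk t′) (walk t))))

  -- Either `t′` is the successor of `t`, or `L ∸ (t′ ∸ t)` is 1, which forces `t` to be 0 and `t′`
  -- to be the last position: the closing edge, supplied by `walk-periodic`.
  adjacent-≤ : ∀ t t′ → t ≤ t′ → t′ < L → (t′ ∸ t) ⊓ (L ∸ (t′ ∸ t)) ≡ 1 →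
               hamming (walk t) (walk t′) ≡ 1
  adjacent-≤ t t′ t≤t′ t′<L e with ⊓-sel (t′ ∸ t) (L ∸ (t′ ∸ t))
  ... | inj₁ e₁ = subst (λ i → hamming (walk t) (walk i) ≡ 1) t′≡ (walk-step t)
    where
    t′≡ : suc t ≡ t′
    t′≡ = trans (cong (_+ t) (sym (trans (sym e₁) e))) (m∸n+n≡m t≤t′)
  ... | inj₂ e₂ = trans (cong (λ w → hamming w (walk t′)) walk-t)
                    (trans (hamming-sym (walk (suc t′)) (walk t′)) (walk-step t′))
    where
    L≡ : L ≡ suc (t′ ∸ t)
    L≡ = trans (sym (m∸n+n≡m (≤-trans (m∸n≤m t′ t) (<⇒≤ t′<L)))) (cong (_+ (t′ ∸ t)) (trans (sym e₂) e))
    t′≤ : t′ ≤ t′ ∸ t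
    t′≤ = ≤-pred (subst (t′ <_) L≡ t′<L)
    t≡0 : t ≡ 0
    t≡0 = +-cancelˡ-≡ (t′ ∸ t) t 0 (trans (m∸n+n≡m t≤t′) (trans (≤-antisym t′≤ (m∸n≤m t′ t)) (sym (+-identityʳ _))))
    walk-t : walk t ≡ walk (suc t′)
    walk-t = trans (cong walk t≡0) (trans (sym walk-periodic)
               (cong walk (trans L≡ (cong suc (cong (t′ ∸_) t≡0)))))

  walk-adjacent : ∀ t t′ → t < L → t′ < L → cycDist L t t′ ≡ 1 → hamming (walk t) (walk t′) ≡ 1
  walk-adjacent t t′ t<L t′<L e with ≤-total t t′
  ... | inj₁ t≤t′ = adjacent-≤ t t′ t≤t′ t′<L (trans (sym (cycDist-≤ t t′ t≤t′)) e)
  ... | inj₂ t′≤t = trans (hamming-sym (walk t) (walk t′))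
    (adjacent-≤ t′ t t′≤t t<L (trans (sym (trans (cycDist-sym t t′) (cycDist-≤ t′ t t′≤t))) e))

  cycDist>0 : ∀ t t′ → t < L → t′ < L → t ≢ t′ → 0 < cycDist L t t′
  cycDist>0 t t′ t<L t′<L t≢t′ = ⊓-glb
    (n≢0⇒n>0 (λ e → t≢t′ (∣m-n∣≡0⇒m≡n e)))
    (m<n⇒0<n∸m (≤-<-trans (∣m-n∣≤m⊔n t t′) (⊔-pres-<m t<L t′<L)))

  code : Fin L → Vertex (2 + m + n * 2)
  code i = walk (toℕ i)

  isCircuitCode : IsCircuitCode (2 + m + n * 2) k L code
  isCircuitCode = record
    { length≥3 = ≤-trans (≤-trans (n≤1+n 3) (^-monoʳ-≤ 2 (s≤s (s≤s (z≤n {m}))))) (m≤m*n N S)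
    ; simple   = λ {i} {j} e → distinct i j e
    ; adjacent = λ i j → walk-adjacent (toℕ i) (toℕ j) (toℕ<n i) (toℕ<n j)
    ; spread   = spread
    }
    where
    spread : ∀ i j → cycDist L (toℕ i) (toℕ j) ⊓ k ≤ hamming (code i) (code j)
    spread i j = walk-spread (toℕ i) (toℕ j) (toℕ<n i) (toℕ<n j)
    distinct : ∀ i j → code i ≡ code j → i ≡ j
    distinct i j e with i ≟ᶠ j
    ... | yes i≡j = i≡j
    -- Distinct positions have positive cyclic distance, so with `1 ≤ k` the spread condition itself
    -- makes the vertices distinct.
    ... | no  i≢j = contradiction e (0<hamming⇒≢ (≤-trans
          (⊓-glb (cycDist>0 (toℕ i) (toℕ j) (toℕ<n i) (toℕ<n j) (i≢j ∘ toℕ-injective)) 1≤k)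
          (spread i j)))

-- Maximal length

encode : ∀ {d} → Vertex d → Fin (2 ^ d)
encode []          = zero
encode (false ∷ x) = combine {2} zero (encode x)
encode (true ∷ x)  = combine {2} (suc zero) (encode x)

encode-injective : ∀ {d} (x y : Vertex d) → encode x ≡ encode y → x ≡ y
encode-injective []          []          _ = refl
encode-injective (false ∷ x) (false ∷ y) e =
  cong (false ∷_) (encode-injective x y (proj₂ (combine-injective {2} zero (encode x) zero (encode y) e)))
encode-injective (true ∷ x)  (true ∷ y)  e =
  cong (true ∷_) (encode-injective x y (proj₂ (combine-injective {2} (suc zero) (encode x) (suc zero) (encode y) e)))
encode-injective (false ∷ x) (true ∷ y)  e
  with () ← proj₁ (combine-injective {2} zero (encode x) (suc zero) (encode y) e)
encode-injective (true ∷ x)  (false ∷ y) e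
  with () ← proj₁ (combine-injective {2} (suc zero) (encode x) zero (encode y) e)

length≤2^d : ∀ {d k n} (c : Fin n → Vertex d) → IsCircuitCode d k n c → n ≤ 2 ^ d
length≤2^d c code = injective⇒≤ {f = encode ∘ c}
  (λ e → IsCircuitCode.simple code (encode-injective _ _ e))

-- Exhaustive search for codes

Searchable : Set → Set₁
Searchable A = ∀ {P : A → Set} → Decidable P → Dec (∃ P)

Bool-searchable : Searchable Bool
Bool-searchable P? = map′ [ (true ,_) , (false ,_) ]′
  (λ { (true , p) → inj₁ p ; (false , p) → inj₂ p }) (P? true ⊎-dec P? false)

Vec-searchable : ∀ {A} → Searchable A → ∀ n → Searchable (Vec A n)
Vec-searchable A? zero    P? = map′ ([] ,_) (λ { ([] , p) → p }) (P? [])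
Vec-searchable A? (suc n) P? = map′ (λ { (a , v , p) → a ∷ v , p }) (λ { (a ∷ v , p) → a , v , p })
  (A? (λ a → Vec-searchable A? n (λ v → P? (a ∷ v))))

isCircuitCode? : ∀ d k n (c : Fin n → Vertex d) → Dec (IsCircuitCode d k n c)
isCircuitCode? d k n c = map′
  (λ (p , q , r , s) → record { length≥3 = p ; simple = λ {i} {j} → q i j ; adjacent = r ; spread = s })
  (λ code → let open IsCircuitCode code in length≥3 , (λ i j → simple {i} {j}) , adjacent , spread)
  ((3 ≤? n)
   ×-dec all? (λ i → all? (λ j → (c i ≟ᵛ c j) →-dec (i ≟ᶠ j)))
   ×-dec all? (λ i → all? (λ j → (cycDist n (toℕ i) (toℕ j) ≟ 1) →-dec (hamming (c i) (c j) ≟ 1)))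
   ×-dec all? (λ i → all? (λ j → (cycDist n (toℕ i) (toℕ j) ⊓ k) ≤? hamming (c i) (c j))))

IsCircuitCode-resp : ∀ {d k n} {c c′ : Fin n → Vertex d} → (∀ i → c i ≡ c′ i) →
                     IsCircuitCode d k n c → IsCircuitCode d k n c′
IsCircuitCode-resp {k = k} {n} c≗c′ code = record
  { length≥3 = length≥3
  ; simple   = λ {i} {j} e → simple (trans (c≗c′ i) (trans e (sym (c≗c′ j))))
  ; adjacent = λ i j e → trans (sym (cong₂ hamming (c≗c′ i) (c≗c′ j))) (adjacent i j e)
  ; spread   = λ i j → subst (cycDist n (toℕ i) (toℕ j) ⊓ k ≤_) (cong₂ hamming (c≗c′ i) (c≗c′ j)) (spread i j)
  }
  where open IsCircuitCode code

HasCircuitCode : ℕ → ℕ → ℕ → Set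
HasCircuitCode d k n = Σ (Fin n → Vertex d) (IsCircuitCode d k n)

-- A maximal length is to be exhibited constructively by testing lengths downwards from `2 ^ d`.
-- Codes are searched as vectors, and `IsCircuitCode-resp` carries the property to the tabulated
-- function, which agrees with the original pointwise.
hasCircuitCode? : ∀ d k n → Dec (HasCircuitCode d k n)
hasCircuitCode? d k n = map′
  (λ (v , code) → lookup v , code)
  (λ (c , code) → tabulate c , IsCircuitCode-resp (λ i → sym (lookup∘tabulate c i)) code)
  (Vec-searchable (Vec-searchable Bool-searchable d) n (λ v → isCircuitCode? d k n (lookup v)))

maximum : ∀ {P : ℕ → Set} → Decidable P → ∀ B → (∀ n → P n → n ≤ B) → ∀ {n₀} → P n₀ →
          ∃ λ K → P K × (∀ n → P n → n ≤ K)
-- All solutions are at most 0, so the given one is already maximal.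
maximum P? zero    bound {n₀} p₀ = n₀ , p₀ , λ n p → ≤-trans (bound n p) z≤n
maximum P? (suc B) bound p₀ with P? (suc B)
... | yes p = suc B , p , bound
... | no ¬p = maximum P? B (λ n p → ≤-pred (≤∧≢⇒< (bound n p) (λ { refl → ¬p p }))) p₀

-- Choice of parameters

n<2^n : ∀ n → n < 2 ^ n
n<2^n zero    = z<s
n<2^n (suc n) = ≤-trans (+-mono-≤ (m^n>0 2 n) (n<2^n n))
  (≤-reflexive (cong (2 ^ n +_) (sym (+-identityʳ _))))

2n≤2^n : ∀ n → 2 * n ≤ 2 ^ n
2n≤2^n zero    = z≤n
2n≤2^n (suc n) = *-monoʳ-≤ 2 (n<2^n n)

-- Induction upwards from `p = 2 * B`, where `2B(1 + B)` is bounded factor by factor by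
-- `2 ^ B * 2 ^ B`; each further step at most doubles the left side.
linear≤2^ : ∀ B p → 2 * B ≤ p → B * (2 + p) ≤ 2 ^ p
linear≤2^ B p 2B≤p = subst (λ q → B * (2 + q) ≤ 2 ^ q) (m∸n+n≡m 2B≤p) (go (p ∸ 2 * B))
  where
  open ≤-Reasoning
  base : ∀ B → B * (2 + 2 * B) ≡ 2 * B * (1 + B)
  base = solve-∀
  double : ∀ B q → B * (3 + q) + B * (1 + q) ≡ 2 * (B * (2 + q))
  double = solve-∀
  go : ∀ r → B * (2 + (r + 2 * B)) ≤ 2 ^ (r + 2 * B)
  go zero = begin
    B * (2 + 2 * B)    ≡⟨ base B ⟩
    2 * B * (1 + B)    ≤⟨ *-mono-≤ (2n≤2^n B) (n<2^n B) ⟩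
    2 ^ B * 2 ^ B      ≡⟨ sym (^-distribˡ-+-* 2 B B) ⟩
    2 ^ (B + B)        ≡⟨ cong (λ i → 2 ^ (B + i)) (sym (+-identityʳ B)) ⟩
    2 ^ (2 * B)        ∎
  go (suc r) = begin
    B * (3 + q)                  ≤⟨ m≤m+n _ (B * (1 + q)) ⟩
    B * (3 + q) + B * (1 + q)    ≡⟨ double B q ⟩
    2 * (B * (2 + q))            ≤⟨ *-monoʳ-≤ 2 (go r) ⟩
    2 * 2 ^ q                    ∎
    where q = r + 2 * B

n≤2^⌈log₂n⌉ : ∀ n → n ≤ 2 ^ ⌈log₂ n ⌉
n≤2^⌈log₂n⌉ = <-rec _ go
  where
  open ≤-Reasoning
  go : ∀ n → (∀ {m} → m < n → m ≤ 2 ^ ⌈log₂ m ⌉) → n ≤ 2 ^ ⌈log₂ n ⌉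
  go zero          _   = z≤n
  go (suc zero)    _   = m^n>0 2 ⌈log₂ 1 ⌉
  go n@(suc (suc n′)) rec = begin
    n                          ≡⟨ sym (⌊n/2⌋+⌈n/2⌉≡n n) ⟩
    ⌊ n /2⌋ + h                ≤⟨ +-monoˡ-≤ h (⌊n/2⌋≤⌈n/2⌉ n) ⟩
    h + h                      ≡⟨ cong (h +_) (sym (+-identityʳ h)) ⟩
    2 * h                      ≤⟨ *-monoʳ-≤ 2 (rec (⌈n/2⌉<n n′)) ⟩
    2 * 2 ^ ⌈log₂ h ⌉          ≡⟨ cong (λ i → 2 ^ suc i) (⌈log₂⌈n/2⌉⌉≡⌈log₂n⌉∸1 n) ⟩
    2 ^ suc (⌈log₂ n ⌉ ∸ 1)    ≡⟨ cong (2 ^_) (m+[n∸m]≡n (⌈log₂⌉-mono-≤ {2} {n} (s≤s (s≤s z≤n)))) ⟩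
    2 ^ ⌈log₂ n ⌉              ∎
    where h = ⌈ n /2⌉

2^p<n : ∀ {n p} → p < ⌈log₂ n ⌉ → 2 ^ p < n
2^p<n {n} {p} p<log = ≰⇒> λ n≤2^p →
  <⇒≱ p<log (≤-trans (⌈log₂⌉-mono-≤ n≤2^p) (≤-reflexive (⌈log₂2^n⌉≡n p)))

-- The register leaves room for at least two Gray bits. With `⌈log₂ d ⌉ = suc p`, `d` exceeds
-- `2 ^ p`, and the threshold on `d` gives `p ≥ 2 * (2 + A)`, as `linear≤2^` requires.
log-bound : ∀ A d → 2 ^ suc (2 * (2 + A)) ≤ d → 2 + A * ⌈log₂ d ⌉ ≤ d
log-bound A d D≤d = go ⌈log₂ d ⌉ refl
    (≤-trans (≤-reflexive (sym (⌈log₂2^n⌉≡n (suc (2 * (2 + A)))))) (⌈log₂⌉-mono-≤ D≤d))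
  where
  open ≤-Reasoning
  expand : ∀ A p → 2 + A * suc p + (2 + (A + 2 * p)) ≡ (2 + A) * (2 + p)
  expand = solve-∀
  go : ∀ ℓ → ℓ ≡ ⌈log₂ d ⌉ → suc (2 * (2 + A)) ≤ ℓ → 2 + A * ⌈log₂ d ⌉ ≤ d
  go (suc p) e (s≤s q) = begin
    2 + A * ⌈log₂ d ⌉                       ≡⟨ cong (λ i → 2 + A * i) (sym e) ⟩
    2 + A * suc p                           ≤⟨ m≤m+n _ _ ⟩
    2 + A * suc p + (2 + (A + 2 * p))       ≡⟨ expand A p ⟩
    (2 + A) * (2 + p)                       ≤⟨ linear≤2^ (2 + A) p q ⟩
    2 ^ p                                   ≤⟨ <⇒≤ (2^p<n (≤-reflexive e)) ⟩
    d                                       ∎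

long-code : ∀ k m b → 1 ≤ k → suc (2 + m) ^ suc k < 2 ^ b →
  ∃ λ n → 2 ^ (2 + m) ≤ n × HasCircuitCode (2 + m + (2 + k) * b * 2) k n
long-code k m b 1≤k small = L , m≤m*n N S , code , isCircuitCode
  where
  f = separating-map (2 + m) (suc k) b small
  open Construction k m b 1≤k (proj₁ f) (proj₂ f)

theorem1 : ∀ (k : ℕ) → 1 ≤ k →
    Σ ℕ λ C → Σ ℕ λ D₀ → ∀ (d : ℕ) → D₀ ≤ d →
    Σ ℕ λ K → IsMaxCircuitCodeLength d k K ×
    (2 ^ d ≤ K * 2 ^ (C * (⌈log₂ d ⌉ * ⌈log₂ d ⌉)) ×
    K ≤ 2 ^ d * 2 ^ (C * (⌈log₂ d ⌉ * ⌈log₂ d ⌉)))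
theorem1 k 1≤k = A , D₀ , bounds
  where
  open ≤-Reasoning
  -- Register bits per unit of `⌈log₂ d ⌉`: `2 + k` copies, `1 + k` colour bits, two bits to a pair.
  A  = (2 + k) * (1 + k) * 2
  D₀ = 2 ^ suc (2 * (2 + A))
  bounds : ∀ d → D₀ ≤ d → Σ ℕ λ K → IsMaxCircuitCodeLength d k K ×
    (2 ^ d ≤ K * 2 ^ (A * (⌈log₂ d ⌉ * ⌈log₂ d ⌉)) ×
     K ≤ 2 ^ d * 2 ^ (A * (⌈log₂ d ⌉ * ⌈log₂ d ⌉)))
  bounds d D₀≤d = K , (proj₁ (proj₂ best) , λ n c code → proj₂ (proj₂ best) n (c , code)) , lower , upper
    where
    ℓ = ⌈log₂ d ⌉
    b = (1 + k) * ℓ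
    -- The Gray code receives all `2 + m` dimensions that the register leaves over; `log-bound`
    -- makes the subtraction exact.
    m = d ∸ (2 + A * ℓ)
    regroup : ∀ k ℓ → (2 + k) * ((1 + k) * ℓ) * 2 ≡ (2 + k) * (1 + k) * 2 * ℓ
    regroup = solve-∀
    2+m+Aℓ≡d : 2 + m + A * ℓ ≡ d
    2+m+Aℓ≡d = trans (cong (2 +_) (+-comm m (A * ℓ))) (m+[n∸m]≡n (log-bound A d D₀≤d))
    d≡ : 2 + m + (2 + k) * b * 2 ≡ d
    d≡ = trans (cong (2 + m +_) (regroup k ℓ)) 2+m+Aℓ≡d
    instance
      ℓ≢0 : NonZero ℓ
      ℓ≢0 = >-nonZero (⌈log₂⌉-mono-≤ {2} {d}
              (≤-trans (*-monoʳ-≤ 2 (m^n>0 2 (2 * (2 + A)))) D₀≤d))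
    3+m<d : 3 + m < d
    3+m<d = begin
      4 + m            ≡⟨ cong (2 +_) (+-comm 2 m) ⟩
      2 + m + 2        ≤⟨ +-monoʳ-≤ (2 + m) (≤-trans (m≤n*m 2 ((2 + k) * (1 + k))) (m≤m*n A ℓ)) ⟩
      2 + m + A * ℓ    ≡⟨ 2+m+Aℓ≡d ⟩
      d                ∎
    small : suc (2 + m) ^ suc k < 2 ^ b
    small = begin-strict
      (3 + m) ^ (1 + k)      <⟨ ^-monoˡ-< (1 + k) 3+m<d ⟩
      d ^ (1 + k)            ≤⟨ ^-monoˡ-≤ (1 + k) (n≤2^⌈log₂n⌉ d) ⟩
      (2 ^ ℓ) ^ (1 + k)      ≡⟨ ^-*-assoc 2 ℓ (1 + k) ⟩
      2 ^ (ℓ * (1 + k))      ≡⟨ cong (2 ^_) (*-comm ℓ (1 + k)) ⟩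
      2 ^ b                  ∎
    long = long-code k m b 1≤k small
    hasLong : HasCircuitCode d k (proj₁ long)
    hasLong = subst (λ i → HasCircuitCode i k (proj₁ long)) d≡ (proj₂ (proj₂ long))
    best = maximum (hasCircuitCode? d k) (2 ^ d) (λ n (c , code) → length≤2^d c code) hasLong
    K = proj₁ best
    lower : 2 ^ d ≤ K * 2 ^ (A * (ℓ * ℓ))
    lower = begin
      2 ^ d                            ≡⟨ cong (2 ^_) (sym 2+m+Aℓ≡d) ⟩
      2 ^ (2 + m + A * ℓ)              ≡⟨ ^-distribˡ-+-* 2 (2 + m) (A * ℓ) ⟩
      -- The construction loses only `A * ℓ` dimensions; `ℓ ≤ ℓ * ℓ`, as `ℓ` is positive, brings
      -- this to the stated form.
      2 ^ (2 + m) * 2 ^ (A * ℓ)        ≤⟨ *-mono-≤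
          (≤-trans (proj₁ (proj₂ long)) (proj₂ (proj₂ best) (proj₁ long) hasLong))
          (^-monoʳ-≤ 2 (*-monoʳ-≤ A (m≤m*n ℓ ℓ))) ⟩
      K * 2 ^ (A * (ℓ * ℓ))            ∎
    upper : K ≤ 2 ^ d * 2 ^ (A * (ℓ * ℓ))
    upper = ≤-trans (length≤2^d (proj₁ (proj₁ (proj₂ best))) (proj₂ (proj₁ (proj₂ best))))
              (m≤m*n (2 ^ d) (2 ^ (A * (ℓ * ℓ))) {{m^n≢0 2 (A * (ℓ * ℓ))}})
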